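{- Let $T$ be a finite tree, let $\mathcal{F}$ be a finite family of subtrees of $T$, and let $G$ be the disjointness graph of $\mathcal{F}$ (vertices are the members of $\mathcal{F}$, two adjacent iff they are vertex-disjoint); equivalently, $G$ is the complement of a chordal graph. Then $c(G)\le p(G)\le 2$.
   Context: A comparability graph is a graph admitting a transitive orientation. $p(G)$ is the minimum number $m$ such that $E(G)$ is the union of the edge sets of $m$ pairwise edge-disjoint comparability subgraphs of $G$; $c(G)$ is the minimum number of comparability subgraphs of $G$ (not necessarily edge-disjoint) whose edge sets cover $E(G)$. -}

module Defs where

open import Data.Fin.Base using (Fin; zero; suc; inject₁; fromℕ)
open import Data.Fin.Properties using () renaming (_≟_ to _≟ᶠ_)
open import Data.Fin.Subset
  using (Subset; _∈_; _⊆_; _∩_; Nonempty; Empty) renaming (⊤ to full)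
open import Data.Fin.Subset.Properties
  using (_∈?_; nonempty?; ∈⊤; ∩-comm; ∩-idem)
open import Data.Nat.Base using (ℕ; suc; _≤_)
open import Data.Product.Base using (Σ; Σ-syntax; ∃; _×_; _,_; proj₁)
open import Data.Sum.Base using (_⊎_)
open import Function.Base using (_∘_)
open import Function.Bundles using (_⇔_; _↔_)
open import Level using (0ℓ)
open import Relation.Binary.Construct.Closure.ReflexiveTransitive using (Star)
open import Relation.Binary.Core using (Rel; _⇒_)
open import Relation.Binary.Definitions
  using (Asymmetric; Decidable; Symmetric; Transitive)
open import Relation.Binary.PropositionalEquality
  using (_≡_; _≢_; sym; subst)
open import Relation.Nullary using (¬_)
open import Relation.Nullary.Decidable using (¬?; _×-dec_)

-- Finite simple graphs whose vertices are drawn from Fin n. The vertex set is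
-- a subset, so that a subgraph of a graph is again a graph of the same type.
record Graph (n : ℕ) : Set₁ where
  field
    vertices : Subset n
    Adj      : Rel (Fin n) 0ℓ
    adj?     : Decidable Adj
    symm     : Symmetric Adj
    irrefl   : ∀ {v} → ¬ Adj v v
    incident : ∀ {u v} → Adj u v → u ∈ vertices

  Vertex : Set
  Vertex = ∃ λ v → v ∈ vertices

open Graph

infix 4 _⊑_ _≅_ _↝_

record _⊑_ {n} (H G : Graph n) : Set where
  field
    vertices⊆ : vertices H ⊆ vertices G
    adj⊆      : Adj H ⇒ Adj G

record _≅_ {n m} (G : Graph n) (H : Graph m) : Set where
  field
    bijection : Vertex G ↔ Vertex H

  open Function.Bundles.Inverse bijection public using (to; from)

  field
    adj⇔ : ∀ (u v : Vertex G) →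
           Adj G (proj₁ u) (proj₁ v) ⇔ Adj H (proj₁ (to u)) (proj₁ (to v))

complement : ∀ {n} → Graph n → Graph n
complement G = record
  { vertices = vertices G
  ; Adj      = λ u v → (u ∈ vertices G × v ∈ vertices G) × u ≢ v × ¬ Adj G u v
  ; adj?     = λ u v → ((u ∈? vertices G) ×-dec (v ∈? vertices G))
                       ×-dec (¬? (u ≟ᶠ v) ×-dec ¬? (adj? G u v))
  ; symm     = λ { ((u∈ , v∈) , u≢v , ¬uv) →
                   (v∈ , u∈) , u≢v ∘ sym , ¬uv ∘ symm G }
  ; irrefl   = λ { (_ , v≢v , _) → v≢v _≡_.refl }
  ; incident = λ { ((u∈ , _) , _) → u∈ }
  }

-- i ↝ j: j follows i in the cyclic order 0, 1, …, k, 0.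
data _↝_ {k : ℕ} : Rel (Fin (suc k)) 0ℓ where
  step : ∀ (i : Fin k) → inject₁ i ↝ suc i
  wrap : fromℕ k ↝ zero

-- A cycle with suc k vertices.
record Cycle {n} (G : Graph n) (k : ℕ) : Set where
  field
    length≥3 : 3 ≤ suc k
    at       : Fin (suc k) → Fin n
    distinct : ∀ {i j} → at i ≡ at j → i ≡ j
    edges    : ∀ {i j} → i ↝ j → Adj G (at i) (at j)

record Chord {n} {G : Graph n} {k} (C : Cycle G k) : Set where
  open Cycle C
  field
    i j     : Fin (suc k)
    ¬edgeᵢⱼ : ¬ i ↝ j
    ¬edgeⱼᵢ : ¬ j ↝ i
    chord   : Adj G (at i) (at j)

IsChordal : ∀ {n} → Graph n → Set
IsChordal G = ∀ {k} (C : Cycle G k) → 4 ≤ suc k → Chord C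

record IsTree {n} (T : Graph n) : Set where
  field
    nonempty  : Nonempty (vertices T)
    connected : ∀ {u v} → u ∈ vertices T → v ∈ vertices T → Star (Adj T) u v
    acyclic   : ∀ {k} → ¬ Cycle T k

record Subtree {n} (T : Graph n) : Set₁ where
  field
    graph    : Graph n
    subgraph : graph ⊑ T
    isTree   : IsTree graph

  nodes : Subset n
  nodes = vertices graph

open Subtree

disjointnessGraph : ∀ {n m} {T : Graph n} → (Fin m → Subtree T) → Graph m
disjointnessGraph F = record
  { vertices = full
  ; Adj      = λ i j → Empty (nodes (F i) ∩ nodes (F j))
  ; adj?     = λ i j → ¬? (nonempty? (nodes (F i) ∩ nodes (F j)))
  ; symm     = λ {i} {j} → subst Empty (∩-comm (nodes (F i)) (nodes (F j)))
  ; irrefl   = λ {i} empty → subst Empty (∩-idem (nodes (F i))) empty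
                               (IsTree.nonempty (isTree (F i)))
  ; incident = λ _ → ∈⊤
  }

IsDisjointnessGraph : ∀ {k} → Graph k → Set₁
IsDisjointnessGraph G =
  Σ[ n ∈ ℕ ] Σ[ m ∈ ℕ ] Σ[ T ∈ Graph n ] IsTree T ×
  Σ[ F ∈ (Fin m → Subtree T) ] G ≅ disjointnessGraph F

record IsTransitiveOrientation {n} (G : Graph n) (_⟶_ : Rel (Fin n) 0ℓ) : Set where
  field
    sound    : ∀ {u v} → u ⟶ v → Adj G u v
    complete : ∀ {u v} → Adj G u v → u ⟶ v ⊎ v ⟶ u
    asym     : Asymmetric _⟶_
    trans    : Transitive _⟶_

IsComparability : ∀ {n} → Graph n → Set₁
IsComparability {n} G = Σ (Rel (Fin n) 0ℓ) (IsTransitiveOrientation G)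

record ComparabilityCover {n} (G : Graph n) (m : ℕ) : Set₁ where
  field
    part          : Fin m → Graph n
    subgraph      : ∀ i → part i ⊑ G
    comparability : ∀ i → IsComparability (part i)
    covers        : ∀ {u v} → Adj G u v → ∃ λ i → Adj (part i) u v

record ComparabilityPartition {n} (G : Graph n) (m : ℕ) : Set₁ where
  field
    cover : ComparabilityCover G m

  open ComparabilityCover cover public

  field
    edgeDisjoint : ∀ {i j} → i ≢ j →
                   ∀ {u v} → Adj (part i) u v → ¬ Adj (part j) u v

IsLeast : (ℕ → Set₁) → ℕ → Set₁
IsLeast P m = P m × (∀ {k} → P k → m ≤ k)

-- IsC G c and IsP G p say that c(G) = c and p(G) = p. They are relations
-- because computing the minima would need a search over all covers.
IsC IsP : ∀ {n} → Graph n → ℕ → Set₁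
IsC G = IsLeast (ComparabilityCover G)
IsP G = IsLeast (ComparabilityPartition G)

{-# OPTIONS --safe #-}

-- Root T and compare subtrees by their tops. If two subtrees meet, the deeper of the two tops lies
-- in both; so on a cycle of pairwise consecutively meeting subtrees the two neighbours of one with a
-- deepest top share that top, which gives the chord. Disjoint pairs whose tops are incomparable
-- are oriented from left to right, disjoint pairs whose tops are comparable towards the root;
-- both orientations are transitive, hence p(G) ≤ 2.
--
-- Conversely a chordal graph has a perfect elimination ordering. Let every vertex have its nearest
-- later neighbour as parent (an extra root if there is none): the vertex v together with its earlier
-- neighbours then forms a subtree with top v, and two such subtrees meet iff the vertices are
-- equal or adjacent.
module Submission where

open import Defs
open import Data.Bool.Base using (true)
open import Data.Empty using (⊥)
open import Data.Fin.Base as Fin using (Fin; zero; suc; inject₁; fromℕ; toℕ; combine; remQuot)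
open import Data.Fin.Properties as Fin
  using (any?; all?; toℕ-inject₁; toℕ-fromℕ; toℕ-injective; toℕ<n; remQuot-combine)
  renaming (_≟_ to _≟ᶠ_)
open import Data.Fin.Subset
  using (Subset; _∈_; _∉_; _⊆_; _⊂_; _⊃_; _∩_; _∪_; _-_; ⁅_⁆; ∣_∣; Nonempty; Empty; inside; outside)
  renaming (⊤ to full)
open import Data.Fin.Subset.Induction using (⊂-wellFounded; ⊃-wellFounded)
open import Data.Fin.Subset.Properties
  using (_∈?_; nonempty?; anySubset?; ∈⊤; x∈⁅x⁆; x∈⁅y⁆⇒x≡y; x≢y⇒x∉⁅y⁆; x∈p∩q⁺; x∈p∩q⁻; p⊆p∪q; q⊆p∪q;
         x∈p∪q⁻; p─q⊆p; x∈p∧x≢y⇒x∈p-y; x∈p⇒p-x⊂p)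
open import Data.List.Base using (List; []; _∷_; length; lookup)
open import Data.List.Membership.Propositional.Properties using (∈-lookup)
open import Data.List.Relation.Unary.All as All using (All)
open import Data.List.Relation.Unary.All.Properties using (¬Any⇒All¬)
open import Data.List.Relation.Unary.Any as Any using (Any; here; there)
open import Data.Nat.Base using (ℕ; zero; suc; _*_; _≤_; _<_; z≤n; s≤s; s≤s⁻¹)
open import Data.Nat.Induction using (<-wellFounded)
open import Data.Nat.Properties
  using (≤-refl; ≤-reflexive; ≤-trans; ≤-total; <⇒≤; <⇒≢; <⇒≱; ≤⇒≯; ≤∧≢⇒<; <-irrefl; <-asym; <-cmp; _<?_;
         <-≤-trans; n≤1+n; 1+n≰n; m≤n⇒m≤1+n)
open import Data.Product.Base using (∃; ∃₂; Σ; _×_; _,_; proj₁; proj₂)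
open import Data.Sum.Base as Sum using (_⊎_; inj₁; inj₂)
open import Data.Unit.Base using (⊤; tt)
open import Data.Vec.Base using ([]; _∷_; here; there; tabulate)
open import Data.Vec.Properties using (lookup∘tabulate; []=⇒lookup; lookup⇒[]=)
open import Data.Vec.Properties.WithK using ([]=-irrelevant)
open import Function.Base using (_∘_; id)
open import Function.Bundles using (_⇔_; mk⇔; mk↔ₛ′; module Equivalence)
open import Induction.WellFounded using (Acc; acc)
open import Level using (0ℓ)
open import Relation.Binary.Construct.Closure.ReflexiveTransitive as Star using (Star; ε; _◅_; _◅◅_)
open import Relation.Binary.Core using (Rel)
open import Relation.Binary.Definitions
  using (Decidable; Symmetric; Total; Transitive; Tri; tri<; tri≈; tri>)
open import Relation.Binary.PropositionalEquality
  using (_≡_; _≢_; refl; sym; trans; cong; subst; subst₂)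
open import Relation.Nullary using (¬_; Dec; yes; no; contradiction)
open import Relation.Nullary.Decidable
  using (does; dec-true; ¬?; _×-dec_; _⊎-dec_; _→-dec_; decidable-stable; map′)
import Relation.Unary as U

open Graph

-- Extremal elements of decidable sets

extremum : ∀ {n} {P : Fin n → Set} {_≲_ : Rel (Fin n) 0ℓ} → Total _≲_ → Transitive _≲_ →
           U.Decidable P → ∃ P → ∃ λ u → P u × (∀ {w} → P w → u ≲ w)
extremum {suc n} {P} {_≲_} total trans P? (v , Pv)
  with P? zero | any? (P? ∘ suc)
... | no ¬P₀ | no ¬Pₛ = contradiction Pv (none v)
  where
  none : ∀ v → ¬ P v
  none zero    = ¬P₀
  none (suc v) = λ Pv → ¬Pₛ (v , Pv)
... | yes P₀ | no ¬Pₛ = zero , P₀ , λ {w} → least w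
  where
  least : ∀ w → P w → zero ≲ w
  -- Totality at a pair of equal elements gives reflexivity.
  least zero    _  = Sum.reduce (total zero zero)
  least (suc w) Pw = contradiction (w , Pw) ¬Pₛ
... | no ¬P₀ | yes ∃P
  with u , Pu , u≲ ← extremum {_≲_ = λ x y → suc x ≲ suc y}
                       (λ x y → total (suc x) (suc y)) trans (P? ∘ suc) ∃P
  = suc u , Pu , λ {w} → least w
  where
  least : ∀ w → P w → suc u ≲ w
  least zero    P₀ = contradiction P₀ ¬P₀
  least (suc w) Pw = u≲ Pw
... | yes P₀ | yes ∃P
  with u , Pu , u≲ ← extremum {_≲_ = λ x y → suc x ≲ suc y}
                       (λ x y → total (suc x) (suc y)) trans (P? ∘ suc) ∃P
  with total zero (suc u)
... | inj₁ 0≲u = zero , P₀ , λ {w} → least w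
  where
  least : ∀ w → P w → zero ≲ w
  least zero    _  = Sum.reduce (total zero zero)
  least (suc w) Pw = trans 0≲u (u≲ Pw)
... | inj₂ u≲0 = suc u , Pu , λ {w} → least w
  where
  least : ∀ w → P w → suc u ≲ w
  least zero    _  = u≲0
  least (suc w) Pw = u≲ Pw

argmax : ∀ {n} (f : Fin n → ℕ) {P : Fin n → Set} → U.Decidable P → ∃ P →
         ∃ λ u → P u × (∀ {w} → P w → f w ≤ f u)
argmax f = extremum {_≲_ = λ u w → f w ≤ f u} (λ u w → ≤-total (f w) (f u)) (λ p q → ≤-trans q p)

argmin : ∀ {n} (f : Fin n → ℕ) {P : Fin n → Set} → U.Decidable P → ∃ P →
         ∃ λ u → P u × (∀ {w} → P w → f u ≤ f w)
argmin f = extremum {_≲_ = λ u w → f u ≤ f w} (λ u w → ≤-total (f u) (f w)) ≤-trans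

-- Shortest paths and cycles

-- Induced x ys t: the vertices x ∷ ys form a path to t without repetitions and without shortcuts.
data Induced {n} (R : Rel (Fin n) 0ℓ) : Fin n → List (Fin n) → Fin n → Set where
  [-] : ∀ {x} → Induced R x [] x
  _∷_ : ∀ {x y ys t} → R x y × x ≢ y × All (λ z → ¬ (x ≡ z ⊎ R x z)) ys →
        Induced R y ys t → Induced R x (y ∷ ys) t

Consecutive : ∀ {k} → Rel (Fin (suc k)) 0ℓ
Consecutive {k} i j = ∃ λ (m : Fin k) → i ≡ inject₁ m × j ≡ suc m

module _ {n} {R : Rel (Fin n) 0ℓ} where

  module _ (R? : Decidable R) where

    -- The vertex `x` is attached at the last vertex of the path that equals it or is related to it,
    -- so nothing after that point offers a shortcut.
    shorten : ∀ {x y ys t} → Induced R y ys t → Any (λ z → x ≡ z ⊎ R x z) (y ∷ ys) →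
              ∃ λ zs → Induced R x zs t
    shorten {x} {y} {ys} p q with Any.any? (λ z → (x ≟ᶠ z) ⊎-dec R? x z) ys
    shorten (_ ∷ p) q               | yes q′ = shorten p q′
    shorten p (there q)             | no ¬q  = contradiction q ¬q
    shorten p (here (inj₁ refl))    | no _   = _ , p
    shorten {x} {y} p (here (inj₂ xRy)) | no ¬q with x ≟ᶠ y
    ... | yes refl = _ , p
    ... | no x≢y   = _ , (xRy , x≢y , ¬Any⇒All¬ _ ¬q) ∷ p

    inducedPath : ∀ {x t} → Star R x t → ∃ λ zs → Induced R x zs t
    inducedPath ε        = [] , [-]
    inducedPath (r ◅ rs) = shorten (proj₂ (inducedPath rs)) (here (inj₂ r))

  private
    variable
      x t : Fin n
      ys  : List (Fin n)

  induced-last : Induced R x ys t → lookup (x ∷ ys) (fromℕ (length ys)) ≡ t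
  induced-last [-]     = refl
  induced-last (_ ∷ p) = induced-last p

  induced-step : Induced R x ys t → ∀ i → R (lookup (x ∷ ys) (inject₁ i)) (lookup ys i)
  induced-step ((r , _) ∷ _) zero    = r
  induced-step (_ ∷ p)       (suc i) = induced-step p i

  induced-fresh : Induced R x ys t → ∀ i → x ≢ lookup ys i
  induced-fresh ((_ , x≢y , _) ∷ _)   zero    = x≢y
  induced-fresh ((_ , _ , far) ∷ _) (suc i) = All.lookup far (∈-lookup i) ∘ inj₁

  induced-distinct : Induced R x ys t → ∀ i j → lookup (x ∷ ys) i ≡ lookup (x ∷ ys) j → i ≡ j
  induced-distinct p       zero    zero    _  = refl
  induced-distinct p       zero    (suc j) eq = contradiction eq (induced-fresh p j)
  induced-distinct p       (suc i) zero    eq = contradiction (sym eq) (induced-fresh p i)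
  induced-distinct (_ ∷ p) (suc i) (suc j) eq = cong suc (induced-distinct p i j eq)

  -- Each vertex carries a proof that it is unrelated to everything after its successor; symmetry
  -- covers the pairs taken backwards.
  induced-chordless : Symmetric R → Induced R x ys t →
    ∀ i j → i ≢ j → R (lookup (x ∷ ys) i) (lookup (x ∷ ys) j) → Consecutive i j ⊎ Consecutive j i
  induced-chordless _ p zero zero i≢j _ = contradiction refl i≢j
  induced-chordless _ (_ ∷ _) zero (suc zero) _ _ = inj₁ (zero , refl , refl)
  induced-chordless _ (_ ∷ _) (suc zero) zero _ _ = inj₂ (zero , refl , refl)
  induced-chordless _ ((_ , _ , far) ∷ _) zero (suc (suc j)) _ r =
    contradiction (inj₂ r) (All.lookup far (∈-lookup j))
  induced-chordless s ((_ , _ , far) ∷ _) (suc (suc i)) zero _ r =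
    contradiction (inj₂ (s r)) (All.lookup far (∈-lookup i))
  induced-chordless s (_ ∷ p) (suc i) (suc j) i≢j r =
    Sum.map shift shift (induced-chordless s p i j (i≢j ∘ cong suc) r)
    where
    shift : ∀ {k} {i j : Fin (suc k)} → Consecutive i j → Consecutive (suc i) (suc j)
    shift (m , refl , refl) = suc m , refl , refl

module _ {n} (G : Graph n) (P : Fin n → Set) where

  Within : Rel (Fin n) 0ℓ
  Within u v = Adj G u v × P u × P v

  within? : U.Decidable P → Decidable Within
  within? P? u v = adj? G u v ×-dec (P? u ×-dec P? v)

  within-sym : Symmetric Within
  within-sym (uv , Pu , Pv) = symm G uv , Pv , Pu

  induced-inside : ∀ {x ys t} → P x → Induced Within x ys t → ∀ i → P (lookup (x ∷ ys) i)
  induced-inside Px _       zero    = Px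
  induced-inside _  (((_ , _ , Py) , _) ∷ p) (suc i) = induced-inside Py p i

  -- The path stays inside `P`, so inserting `v` between its two ends repeats no vertex. Since
  -- `x ≢ t`, the path has an edge and the cycle at least three vertices.
  closePath : ∀ {v x ys t} → ¬ P v → P x → Adj G v x → Adj G v t → x ≢ t →
              Induced Within x ys t → Cycle G (suc (length ys))
  closePath {v} {x} {ys} {t} ¬Pv Px vx vt x≢t p = record
    { length≥3 = long p
    ; at       = at
    ; distinct = λ {i} {j} → distinct i j
    ; edges    = edges
    }
    where
    at : Fin (suc (suc (length ys))) → Fin n
    at = lookup (v ∷ x ∷ ys)

    long : ∀ {ys} → Induced Within x ys t → 3 ≤ suc (suc (length ys))
    long [-]     = contradiction refl x≢t
    long (_ ∷ _) = s≤s (s≤s (s≤s z≤n))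

    v∉ : ∀ i → v ≢ lookup (x ∷ ys) i
    v∉ i eq = ¬Pv (subst P (sym eq) (induced-inside Px p i))

    distinct : ∀ i j → at i ≡ at j → i ≡ j
    distinct zero    zero    _  = refl
    distinct zero    (suc j) eq = contradiction eq (v∉ j)
    distinct (suc i) zero    eq = contradiction (sym eq) (v∉ i)
    distinct (suc i) (suc j) eq = cong suc (induced-distinct p i j eq)

    edges : ∀ {i j} → i ↝ j → Adj G (at i) (at j)
    edges (step zero)    = vx
    edges (step (suc i)) = proj₁ (induced-step p i)
    edges wrap           = subst (λ u → Adj G u v) (sym (induced-last p)) (symm G vt)

-- Arithmetic of the cyclic order

↝-toℕ : ∀ {k} {i j : Fin (suc k)} → i ↝ j → toℕ j ≡ suc (toℕ i) ⊎ (toℕ i ≡ k × toℕ j ≡ 0)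
↝-toℕ (step i)   = inj₁ (cong suc (sym (toℕ-inject₁ i)))
↝-toℕ {k} wrap = inj₂ (toℕ-fromℕ k , refl)

next : ∀ {k} (i : Fin (suc k)) → ∃ λ j → i ↝ j
next {zero}  zero    = zero , wrap
next {suc k} zero    = suc zero , step zero
next {suc k} (suc i) with next i
... | _ , step j = suc (suc j) , step (suc j)
... | _ , wrap   = zero , wrap

prev : ∀ {k} (i : Fin (suc k)) → ∃ λ j → j ↝ i
prev {k} zero = fromℕ k , wrap
prev (suc i)  = inject₁ i , step i

↝-deterministic : ∀ {k} {i j l : Fin (suc k)} → i ↝ j → i ↝ l → j ≡ l
↝-deterministic {j = j} {l} p q with ↝-toℕ p | ↝-toℕ q
... | inj₁ a       | inj₁ b       = toℕ-injective (trans a (sym b))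
... | inj₂ (_ , a) | inj₂ (_ , b) = toℕ-injective (trans a (sym b))
... | inj₁ a       | inj₂ (b , _) = contradiction (toℕ<n j) (<-irrefl (trans a (cong suc b)))
... | inj₂ (b , _) | inj₁ a       = contradiction (toℕ<n l) (<-irrefl (trans a (cong suc b)))

-- Three steps without a wrap cannot return to the start; exactly one wrap gives `k ≡ 2`, and two
-- wraps give `k ≡ 0`.
↝-round₃ : ∀ {k} {i j l : Fin (suc k)} → i ↝ j → j ↝ l → l ↝ i → k ≤ 2
↝-round₃ p q r with ↝-toℕ p | ↝-toℕ q | ↝-toℕ r
... | inj₁ a | inj₁ b | inj₁ c =
  contradiction (trans c (cong suc (trans b (cong suc a)))) (<⇒≢ (s≤s (m≤n⇒m≤1+n (n≤1+n _))))
... | inj₁ a | inj₁ b | inj₂ (c , d) =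
  ≤-reflexive (trans (sym c) (trans b (cong suc (trans a (cong suc d)))))
... | inj₁ a | inj₂ (c , d) | inj₁ b =
  ≤-reflexive (trans (sym c) (trans a (cong suc (trans b (cong suc d)))))
... | inj₂ (c , d) | inj₁ a | inj₁ b =
  ≤-reflexive (trans (sym c) (trans b (cong suc (trans a (cong suc d)))))
... | inj₁ a | inj₂ (c , d) | inj₂ (e , f) = ≤-trans (≤-reflexive (trans (sym e) d)) z≤n
... | inj₂ (c , d) | inj₂ (e , f) | _ = ≤-trans (≤-reflexive (trans (sym e) d)) z≤n
... | inj₂ (c , d) | inj₁ a | inj₂ (e , f) = ≤-trans (≤-reflexive (trans (sym c) f)) z≤n

↝-round₂ : ∀ {k} {i j : Fin (suc k)} → i ↝ j → j ↝ i → k ≤ 1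
↝-round₂ p q with ↝-toℕ p | ↝-toℕ q
... | inj₁ a | inj₁ b = contradiction (trans b (cong suc a)) (<⇒≢ (s≤s (n≤1+n _)))
... | inj₁ a | inj₂ (c , d) = ≤-reflexive (trans (sym c) (trans a (cong suc d)))
... | inj₂ (c , d) | inj₁ a = ≤-reflexive (trans (sym c) (trans a (cong suc d)))
... | inj₂ (c , d) | inj₂ (e , f) = ≤-trans (≤-reflexive (trans (sym c) f)) z≤n

-- Rooted trees

neighbour∈ : ∀ {n} (G : Graph n) {u v} → Adj G u v → v ∈ vertices G
neighbour∈ G uv = incident G (symm G uv)

-- depth need not be the distance from the root: any rank will do along which every vertex
-- has at most one neighbour that is not deeper.
record Rooted {n} (T : Graph n) : Set where
  field
    root  : Fin n
    root∈ : root ∈ vertices T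
    depth : Fin n → ℕ

  Parent : Rel (Fin n) 0ℓ
  Parent x y = Adj T x y × depth y < depth x

  field
    unique : ∀ {x y z} → Adj T x y → Adj T x z → depth y ≤ depth x → depth z ≤ depth x → y ≡ z
    ascend : ∀ {x} → x ∈ vertices T → Star Parent x root

-- Both neighbours of a deepest vertex of a cycle would be its parent.
rooted⇒isTree : ∀ {n} {T : Graph n} → Rooted T → IsTree T
rooted⇒isTree {T = T} R = record
  { nonempty  = root , root∈
  ; connected = λ u∈ v∈ → climb u∈ ◅◅ Star.reverse (symm T) (climb v∈)
  ; acyclic   = acyclic
  }
  where
  open Rooted R

  climb : ∀ {x} → x ∈ vertices T → Star (Adj T) x root
  climb x∈ = Star.map proj₁ (ascend x∈)

  acyclic : ∀ {k} → ¬ Cycle T k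
  acyclic C = contradiction (↝-round₂ i↝s (subst (_↝ i) p≡s p↝i)) (<⇒≱ (s≤s⁻¹ length≥3))
    where
    open Cycle C
    deepest-spec = argmax (depth ∘ at) {λ _ → ⊤} (λ _ → yes tt) (zero , tt)
    i = proj₁ deepest-spec
    deepest = proj₂ (proj₂ deepest-spec)
    p↝i = proj₂ (prev i)
    i↝s = proj₂ (next i)
    p≡s : proj₁ (prev i) ≡ proj₁ (next i)
    p≡s = distinct (unique (symm T (edges p↝i)) (edges i↝s) (deepest tt) (deepest tt))

-- Rooting a tree by distance

least : ∀ {P : ℕ → Set} → U.Decidable P → ∀ {m} → P m → ∃ λ l → P l × (∀ {k} → P k → l ≤ k)
least P? {m} Pm with P? 0
least P? {m}     Pm | yes P₀ = 0 , P₀ , λ _ → z≤n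
least P? {zero}  Pm | no ¬P₀ = contradiction Pm ¬P₀
least {P} P? {suc m} Pm | no ¬P₀ with l , Pl , l≤ ← least (P? ∘ suc) Pm =
  suc l , Pl , λ {k} → least′ k
  where
  least′ : ∀ k → P k → suc l ≤ k
  least′ zero    P₀ = contradiction P₀ ¬P₀
  least′ (suc k) Pk = s≤s (l≤ Pk)

module Distance {n} {T : Graph n} (isTree : IsTree T) where
  open IsTree isTree

  private
    root : Fin n
    root = proj₁ nonempty

    -- The first summand of the successor case makes this a walk of at most `m` edges to the root.
    Reach : ℕ → Fin n → Set
    Reach zero    x = x ≡ root
    Reach (suc m) x = Reach m x ⊎ ∃ λ y → Adj T x y × Reach m y

    reach? : ∀ m → U.Decidable (Reach m)
    reach? zero    x = x ≟ᶠ root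
    reach? (suc m) x = reach? m x ⊎-dec any? λ y → adj? T x y ×-dec reach? m y

    reachable : ∀ {x} → Star (Adj T) x root → ∃ λ m → Reach m x
    reachable ε        = 0 , refl
    reachable (e ◅ es) with m , r ← reachable es = suc m , inj₂ (_ , e , r)

    distance : ∀ {x} → x ∈ vertices T → ∃ λ l → Reach l x × (∀ {k} → Reach k x → l ≤ k)
    distance {x} x∈ = least (λ m → reach? m x) (proj₂ (reachable (connected x∈ (proj₂ nonempty))))

    depth : Fin n → ℕ
    depth x with x ∈? vertices T
    ... | yes x∈ = proj₁ (distance x∈)
    -- A default value off the tree; `depth-correct` concerns vertices of `T` only.
    ... | no  _  = 0

    depth-correct : ∀ {x} → x ∈ vertices T → Reach (depth x) x × (∀ {k} → Reach k x → depth x ≤ k)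
    depth-correct {x} x∈ with x ∈? vertices T
    ... | yes x∈ = proj₂ (distance x∈)
    ... | no x∉  = contradiction x∈ x∉

    Parent : Rel (Fin n) 0ℓ
    Parent x y = Adj T x y × depth y < depth x

    -- The first edge of a shortest walk to the root leads to a vertex strictly closer to it.
    parent : ∀ {x} → x ∈ vertices T → x ≢ root → ∃ (Parent x)
    parent {x} x∈ x≢root with depth x | depth-correct x∈
    ... | zero  | x≡root , _         = contradiction x≡root x≢root
    ... | suc m | inj₁ r , shortest  = contradiction (shortest r) 1+n≰n
    ... | suc m | inj₂ (y , xy , r) , _ = y , xy , s≤s (proj₂ (depth-correct (neighbour∈ T xy)) r)

    ascend : ∀ {x} → Acc _<_ (depth x) → x ∈ vertices T → Star Parent x root
    ascend {x} (acc rs) x∈ with x ≟ᶠ root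
    ... | yes refl   = ε
    ... | no x≢root with y , xy , y<x ← parent x∈ x≢root =
      (xy , y<x) ◅ ascend (rs y<x) (neighbour∈ T xy)

    -- Depth strictly drops along the walk and starts no deeper than `v`, so every vertex after the
    -- first is less deep than `v`.
    avoiding : ∀ {v x t} → x ≢ v → depth x ≤ depth v → Star Parent x t → Star (Within T (_≢ v)) x t
    avoiding x≢v x≤v ε = ε
    avoiding x≢v x≤v ((xy , y<x) ◅ ps) =
      (xy , x≢v , y≢v) ◅ avoiding y≢v (<⇒≤ y<v) ps
      where
      y<v = <-≤-trans y<x x≤v
      y≢v : _ ≢ _
      y≢v refl = <-irrefl refl y<v

  -- Two neighbours of x of depth at most depth x are joined through the root by a walk avoiding x.
  rooted : Rooted T
  rooted = record
    { root   = root
    ; root∈  = proj₂ nonempty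
    ; depth  = depth
    ; unique = unique
    ; ascend = λ x∈ → ascend (<-wellFounded _) x∈
    }
    where
    unique : ∀ {x y z} → Adj T x y → Adj T x z → depth y ≤ depth x → depth z ≤ depth x → y ≡ z
    unique {x} {y} {z} xy xz y≤x z≤x with y ≟ᶠ z
    ... | yes y≡z = y≡z
    ... | no y≢z  = contradiction
      (closePath T (_≢ x) (λ x≢x → x≢x refl) (≢x xy) xy xz y≢z
        (proj₂ (inducedPath (within? T (_≢ x) λ u → ¬? (u ≟ᶠ x)) walk)))
      acyclic
      where
      ≢x : ∀ {u} → Adj T x u → u ≢ x
      ≢x xx refl = irrefl T xx

      toRoot : ∀ {u} → Adj T x u → depth u ≤ depth x → Star (Within T (_≢ x)) u root
      toRoot xu u≤x = avoiding (≢x xu) u≤x (ascend (<-wellFounded _) (neighbour∈ T xu))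

      walk : Star (Within T (_≢ x)) y z
      walk = toRoot xy y≤x ◅◅ Star.reverse (within-sym T (_≢ x)) (toRoot xz z≤x)

-- Ancestors and the left-to-right order

module Ancestors {n} {T : Graph n} (R : Rooted T) where
  open Rooted R public

  infix 4 _⟿_ _⊲_

  -- The walk goes upwards: the right-hand vertex is an ancestor of the left-hand one, or equal to
  -- it.
  _⟿_ : Rel (Fin n) 0ℓ
  _⟿_ = Star Parent

  private
    variable
      a b s t u w x y z : Fin n

  parent-unique : Parent x y → Parent x z → y ≡ z
  parent-unique (xy , y<x) (xz , z<x) = unique xy xz (<⇒≤ y<x) (<⇒≤ z<x)

  ⟿-depth : x ⟿ y → depth y ≤ depth x
  ⟿-depth ε              = ≤-refl
  ⟿-depth ((_ , y<x) ◅ p) = ≤-trans (⟿-depth p) (<⇒≤ y<x)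

  ⟿-flat : x ⟿ y → depth x ≤ depth y → x ≡ y
  ⟿-flat ε               _   = refl
  ⟿-flat ((_ , y<x) ◅ p) x≤y = contradiction (≤-trans x≤y (⟿-depth p)) (<⇒≱ y<x)

  -- Parents are unique, so two upward walks from `x` coincide until one of them stops.
  ⟿-comparable : x ⟿ y → x ⟿ z → y ⟿ z ⊎ z ⟿ y
  ⟿-comparable ε       q       = inj₁ q
  ⟿-comparable (p ◅ ps) ε        = inj₂ (p ◅ ps)
  ⟿-comparable (p ◅ ps) (q ◅ qs) with refl ← parent-unique p q = ⟿-comparable ps qs

  root-top : ¬ Parent root y
  root-top (ry , y<r) = <⇒≱ y<r (⟿-depth (ascend (neighbour∈ T ry)))

  -- Ends of equal depth are impossible: a parent of either end would, by `unique`, be the other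
  -- end, and if neither has a parent, both are the root.
  oriented : Adj T x y → Parent x y ⊎ Parent y x
  oriented {x} {y} xy with <-cmp (depth x) (depth y)
  ... | tri< x<y _ _ = inj₂ (symm T xy , x<y)
  ... | tri> _ _ y<x = inj₁ (xy , y<x)
  ... | tri≈ _ x≡y _ with ascend (incident T xy) | ascend (neighbour∈ T xy)
  ...   | ε | ε = contradiction xy (irrefl T)
  ...   | (xw , w<x) ◅ _ | _ with refl ← unique xy xw (≤-reflexive (sym x≡y)) (<⇒≤ w<x) =
    contradiction w<x (<-irrefl (sym x≡y))
  ...   | ε | (yw , w<y) ◅ _ with refl ← unique (symm T xy) yw (≤-reflexive x≡y) (<⇒≤ w<y) =
    contradiction w<y (<-irrefl x≡y)

  -- All ancestors of `x` lie on its walk to the root, which is searched step by step.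
  ⟿? : x ∈ vertices T → ∀ y → Dec (x ⟿ y)
  ⟿? x∈ = go (ascend x∈)
    where
    go : x ⟿ root → ∀ y → Dec (x ⟿ y)
    go {x} p y with x ≟ᶠ y
    go p y | yes refl = yes ε
    go ε y | no x≢y   = no λ { ε → x≢y refl ; (q ◅ _) → root-top q }
    go (p ◅ ps) y | no x≢y with go ps y
    ... | yes q = yes (p ◅ q)
    ... | no ¬q = no λ { ε → x≢y refl
                       ; (q ◅ qs) → ¬q (subst (_⟿ y) (parent-unique q p) qs) }

  Siblings : Rel (Fin n) 0ℓ
  Siblings a b = ∃ λ w → Parent a w × Parent b w

  siblings-≡ : Siblings a b → a ⟿ b → a ≡ b
  siblings-≡ _ ε = refl
  siblings-≡ (w , aw , _ , w<b) (p ◅ ps) with refl ← parent-unique aw p =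
    contradiction (⟿-depth ps) (<⇒≱ w<b)

  -- s lies to the left of t when the vertex order is used to arrange siblings.
  _⊲_ : Rel (Fin n) 0ℓ
  s ⊲ t = ∃₂ λ a b → (s ⟿ a × t ⟿ b) × a Fin.< b × Siblings a b

  -- Ancestors of a common vertex are comparable, but distinct siblings are not.
  ⊲-apart : s ⊲ t → u ⟿ s → ¬ u ⟿ t
  ⊲-apart (a , b , (sa , tb) , a<b , w , aw , bw) us ut with ⟿-comparable (us ◅◅ sa) (ut ◅◅ tb)
  ... | inj₁ ab = Fin.<-irrefl (siblings-≡ (w , aw , bw) ab) a<b
  ... | inj₂ ba = Fin.<-irrefl (sym (siblings-≡ (w , bw , aw) ba)) a<b

  -- Both `b` and `b′` lie above the middle vertex, so they are comparable. If they are equal, the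
  -- sibling orders compose; otherwise the fork nearer the root separates the outer vertices.
  ⊲-trans : Transitive _⊲_
  ⊲-trans (a , b , (sa , tb) , a<b , w , aw , bw) (b′ , c , (tb′ , uc) , b′<c , w′ , b′w′ , cw′)
    with ⟿-comparable tb tb′
  ... | inj₁ ε with refl ← parent-unique bw b′w′ =
    a , c , (sa , uc) , Fin.<-trans a<b b′<c , w , aw , cw′
  ... | inj₂ ε with refl ← parent-unique bw b′w′ =
    a , c , (sa , uc) , Fin.<-trans a<b b′<c , w , aw , cw′
  ... | inj₁ (p ◅ ps) with refl ← parent-unique bw p =
    b′ , c , (sa ◅◅ aw ◅ ps , uc) , b′<c , w′ , b′w′ , cw′
  ... | inj₂ (p ◅ ps) with refl ← parent-unique b′w′ p =
    a , b , (sa , uc ◅◅ cw′ ◅ ps) , a<b , w , aw , bw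

  ⊲-asym : s ⊲ t → ¬ t ⊲ s
  ⊲-asym st ts = ⊲-apart (⊲-trans st ts) ε ε

  private
    lastStep : s ⟿ w → s ≡ w ⊎ ∃ λ a → s ⟿ a × Parent a w
    lastStep ε = inj₁ refl
    lastStep (p ◅ ps) with lastStep ps
    ... | inj₁ refl          = inj₂ (_ , ε , p)
    ... | inj₂ (a , sa , aw) = inj₂ (a , p ◅ sa , aw)

    -- The walk from `t` to the root eventually meets an ancestor of `s`, the root at the latest;
    -- `w` is the first such vertex and `b` the one just before it.
    fork : s ∈ vertices T → t ⟿ root → ¬ s ⟿ t →
           ∃₂ λ b w → t ⟿ b × Parent b w × ¬ s ⟿ b × s ⟿ w
    fork s∈ ε        ¬st = contradiction (ascend s∈) ¬st
    fork s∈ (_◅_ {j = w} p ps) ¬st with ⟿? s∈ w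
    ... | yes sw = _ , w , ε , p , ¬st , sw
    ... | no ¬sw with b , w′ , tb , rest ← fork s∈ ps ¬sw = b , w′ , p ◅ tb , rest

  -- At the lowest common ancestor `w`, the children `a` towards `s` and `b` towards `t` are
  -- distinct, and their order decides.
  ⊲-total : s ∈ vertices T → t ∈ vertices T → ¬ s ⟿ t → ¬ t ⟿ s → s ⊲ t ⊎ t ⊲ s
  ⊲-total s∈ t∈ ¬st ¬ts with fork s∈ (ascend t∈) ¬st
  ... | b , w , tb , bw , ¬sb , sw with lastStep sw
  ...   | inj₁ refl = contradiction (tb ◅◅ bw ◅ ε) ¬ts
  ...   | inj₂ (a , sa , aw) with Fin.<-cmp a b
  ...     | tri< a<b _ _    = inj₁ (a , b , (sa , tb) , a<b , w , aw , bw)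
  ...     | tri≈ _ refl _   = contradiction sa ¬sb
  ...     | tri> _ _ b<a    = inj₂ (b , a , (tb , sa) , b<a , w , bw , aw)

  -- Tops of subtrees

  module _ (S : Subtree T) where
    open Subtree S
    open IsTree isTree

    top-spec : ∃ λ t → t ∈ nodes × (∀ {x} → x ∈ nodes → depth t ≤ depth x)
    top-spec = argmin depth (_∈? nodes) nonempty

    top : Fin n
    top = proj₁ top-spec

    top∈ : top ∈ nodes
    top∈ = proj₁ (proj₂ top-spec)

    private
      -- Detours are cut out of a walk in `S`: a step down is followed by a step up to the same
      -- parent, and the two cancel. No step down can end at the top, which has least depth.
      climb : x ∈ nodes → Star (Adj graph) x top → Star (λ u v → Parent u v × v ∈ nodes) x top
      climb x∈ ε = ε
      climb x∈ (xy ◅ es) with climb (neighbour∈ graph xy) es | oriented (_⊑_.adj⊆ subgraph xy)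
      ... | ps | inj₁ x→y = (x→y , neighbour∈ graph xy) ◅ ps
      ... | ε  | inj₂ (_ , x<y) = contradiction x<y (≤⇒≯ (proj₂ (proj₂ top-spec) x∈))
      ... | (y→z , _) ◅ ps | inj₂ y→x with refl ← parent-unique y→x y→z = ps

      chain : x ∈ nodes → Star (λ u v → Parent u v × v ∈ nodes) x top
      chain x∈ = climb x∈ (connected x∈ top∈)

    top-above : x ∈ nodes → x ⟿ top
    top-above = Star.map proj₁ ∘ chain

    -- The upward walk from `x` to the top inside `S` is the only one, and `y` lies on it.
    top-convex : x ∈ nodes → x ⟿ y → y ⟿ top → y ∈ nodes
    top-convex x∈ = go x∈ (chain x∈)
      where
      go : x ∈ nodes → Star (λ u v → Parent u v × v ∈ nodes) x top → x ⟿ y → y ⟿ top → y ∈ nodes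
      go x∈ _ ε _ = x∈
      go x∈ ε ((_ , y<x) ◅ ps) q = contradiction (⟿-depth (ps ◅◅ q)) (<⇒≱ y<x)
      go x∈ ((p , y∈) ◅ ps) (p′ ◅ ps′) q with refl ← parent-unique p p′ = go y∈ ps ps′ q

  Meet : Rel (Subtree T) 0ℓ
  Meet S S′ = Nonempty (Subtree.nodes S ∩ Subtree.nodes S′)

  -- Both tops are ancestors of a common vertex and hence comparable. The deeper one lies between
  -- that vertex and the other top, so convexity applies.
  deeper-top : ∀ {S S′} → Meet S S′ → depth (top S′) ≤ depth (top S) →
               top S ⟿ top S′ × top S ∈ Subtree.nodes S′
  deeper-top {S} {S′} (x , x∈) t′≤t with x∈S , x∈S′ ← x∈p∩q⁻ _ _ x∈ =
    t⟿t′ , top-convex S′ x∈S′ (top-above S x∈S) t⟿t′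
    where
    t⟿t′ : top S ⟿ top S′
    t⟿t′ with ⟿-comparable (top-above S x∈S) (top-above S′ x∈S′)
    ... | inj₁ p = p
    -- The reverse comparison, together with the depths, makes the tops equal.
    ... | inj₂ p = subst (_⟿ top S′) (⟿-flat p t′≤t) ε

-- Families of subtrees

module Family {n m} {T : Graph n} (isTree : IsTree T) (F : Fin m → Subtree T) where
  open Ancestors (Distance.rooted isTree)

  private
    variable
      i j k : Fin m

  D : Graph m
  D = disjointnessGraph F

  apex : Fin m → Fin n
  apex i = top (F i)

  apex∈ : ∀ i → apex i ∈ vertices T
  apex∈ i = _⊑_.vertices⊆ (Subtree.subgraph (F i)) (top∈ (F i))

  infix 4 _≼_
  _≼_ : Rel (Fin m) 0ℓ
  i ≼ j = apex i ⟿ apex j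

  ≼? : Decidable _≼_
  ≼? i j = ⟿? (apex∈ i) (apex j)

  apex∈⇒meet : apex i ∈ Subtree.nodes (F j) → Meet (F i) (F j)
  apex∈⇒meet {i} i∈ = apex i , x∈p∩q⁺ (top∈ (F i) , i∈)

  meet-sym : Meet (F i) (F j) → Meet (F j) (F i)
  meet-sym (x , x∈) with x∈i , x∈j ← x∈p∩q⁻ _ _ x∈ = x , x∈p∩q⁺ (x∈j , x∈i)

  meet⇒≼ : Meet (F i) (F j) → i ≼ j ⊎ j ≼ i
  meet⇒≼ {i} {j} meet with ≤-total (depth (apex j)) (depth (apex i))
  ... | inj₁ j≤i = inj₁ (proj₁ (deeper-top {F i} {F j} meet j≤i))
  ... | inj₂ i≤j = inj₂ (proj₁ (deeper-top {F j} {F i} (meet-sym {i} {j} meet) i≤j))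

  -- Only `aligned` mentions disjointness: incomparable tops already force it, by `meet⇒≼`.
  sideways aligned : Graph m

  sideways = record
    { vertices = full
    ; Adj      = λ i j → ¬ i ≼ j × ¬ j ≼ i
    ; adj?     = λ i j → ¬? (≼? i j) ×-dec ¬? (≼? j i)
    ; symm     = λ (¬ij , ¬ji) → ¬ji , ¬ij
    ; irrefl   = λ (¬ii , _) → ¬ii ε
    ; incident = λ _ → ∈⊤
    }

  aligned = record
    { vertices = full
    ; Adj      = λ i j → Adj D i j × (i ≼ j ⊎ j ≼ i)
    ; adj?     = λ i j → adj? D i j ×-dec (≼? i j ⊎-dec ≼? j i)
    ; symm     = λ {i} {j} (d , c) → symm D {i} {j} d , Sum.swap c
    ; irrefl   = λ {i} (d , _) → irrefl D {i} d
    ; incident = λ _ → ∈⊤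
    }

  sideways-comparability : IsComparability sideways
  sideways-comparability = (λ i j → apex i ⊲ apex j) , record
    { sound    = λ i⊲j → (λ ij → ⊲-apart i⊲j ε ij) , (λ ji → ⊲-apart i⊲j ji ε)
    ; complete = λ {i} {j} (¬ij , ¬ji) → ⊲-total (apex∈ i) (apex∈ j) ¬ij ¬ji
    ; asym     = ⊲-asym
    ; trans    = ⊲-trans
    }

  -- A subtree F k meeting F i also contains every vertex between their tops.
  aligned-trans : i ≼ j → j ≼ k → Adj D j k → Adj D i k
  aligned-trans {i} {j} {k} ij jk disjoint meet =
    disjoint (apex∈⇒meet {j} {k}
      (top-convex (F k) (proj₂ (deeper-top {F i} {F k} meet (⟿-depth (ij ◅◅ jk)))) ij jk))

  aligned-comparability : IsComparability aligned
  aligned-comparability = (λ i j → Adj D i j × i ≼ j) , record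
    { sound    = λ (d , ij) → d , inj₁ ij
    ; complete = λ { {i} {j} (d , inj₁ ij) → inj₁ (d , ij)
                   ; {i} {j} (d , inj₂ ji) → inj₂ (symm D {i} {j} d , ji) }
    -- Tops above each other coincide, and would be a common vertex of the disjoint subtrees.
    ; asym     = λ { {i} {j} (d , ij) (_ , ji) →
                     d (apex∈⇒meet {i} {j} (subst (_∈ Subtree.nodes (F j))
                         (sym (⟿-flat ij (⟿-depth ji))) (top∈ (F j)))) }
    ; trans    = λ { {i} {j} {k} (_ , ij) (d , jk) → aligned-trans {i} {j} {k} ij jk d , ij ◅◅ jk }
    }

  parts : Fin 2 → Graph m
  parts zero       = sideways
  parts (suc zero) = aligned

  partition : ComparabilityPartition D 2
  partition = record
    { cover = record
      { part          = parts
      ; subgraph      = λ { zero → record { vertices⊆ = id ; adj⊆ = λ {i} {j} → sideways⊆ {i} {j} }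
                          ; (suc zero) → record { vertices⊆ = id ; adj⊆ = proj₁ } }
      ; comparability = λ { zero → sideways-comparability ; (suc zero) → aligned-comparability }
      ; covers        = λ {i} {j} d → covers {i} {j} d
      }
    ; edgeDisjoint = λ { {zero}     {zero}     0≢0 → contradiction refl 0≢0
                       ; {zero}     {suc zero} _ (¬ij , ¬ji) (_ , c) → Sum.[ ¬ij , ¬ji ] c
                       ; {suc zero} {zero}     _ (_ , c) (¬ij , ¬ji) → Sum.[ ¬ij , ¬ji ] c
                       ; {suc zero} {suc zero} 1≢1 → contradiction refl 1≢1 }
    }
    where
    sideways⊆ : Adj sideways i j → Adj D i j
    sideways⊆ {i} {j} (¬ij , ¬ji) meet = Sum.[ ¬ij , ¬ji ] (meet⇒≼ {i} {j} meet)

    covers : Adj D i j → ∃ λ c → Adj (parts c) i j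
    covers {i} {j} d with ≼? i j | ≼? j i
    ... | yes ij | _      = suc zero , d , inj₁ ij
    ... | no _   | yes ji = suc zero , d , inj₂ ji
    ... | no ¬ij | no ¬ji = zero , ¬ij , ¬ji

  chordal : ∀ {l} {G : Graph l} → G ≅ D → IsChordal (complement G)
  chordal {G = G} iso {k} C 4≤k = record
    { i       = before
    ; j       = after
    -- The successor of `before` is `peak`, so `after` would be `peak` and follow itself.
    ; ¬edgeᵢⱼ = λ p↝s → let i↝i = subst (peak ↝_) (↝-deterministic p↝s before↝) ↝after in
                  contradiction (↝-round₂ i↝i i↝i) (<⇒≱ (<⇒≤ (s≤s⁻¹ 4≤k)))
    ; ¬edgeⱼᵢ = λ s↝p → contradiction (↝-round₃ before↝ ↝after s↝p) (<⇒≱ (s≤s⁻¹ 4≤k))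
    ; chord   = (mem before , mem after) , before≢after ∘ distinct ,
                -- The top belonging to `peak` lies in both neighbouring subtrees, so they are not
                -- disjoint.
                λ ps → Equivalence.to (adj⇔ (vertex before) (vertex after)) ps
                  (apex (ix peak) ,
                   x∈p∩q⁺ (contains (symm (complement G) (edges before↝)) , contains (edges ↝after)))
    }
    where
    open Cycle C
    open _≅_ iso

    mem : ∀ i → at i ∈ vertices G
    mem i = incident (complement G) (edges (proj₂ (next i)))

    vertex : Fin (suc k) → Vertex G
    vertex i = at i , mem i

    ix : Fin (suc k) → Fin m
    ix i = proj₁ (to (vertex i))

    meets : ∀ {i j} → Adj (complement G) (at i) (at j) → Meet (F (ix i)) (F (ix j))
    meets {i} {j} (_ , _ , ¬ij) = decidable-stable (nonempty? _)
      (¬ij ∘ Equivalence.from (adj⇔ (vertex i) (vertex j)))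

    deepest-spec : ∃ λ i → ⊤ × (∀ {j} → ⊤ → depth (apex (ix j)) ≤ depth (apex (ix i)))
    deepest-spec = argmax (λ i → depth (apex (ix i))) (λ _ → yes tt) (zero , tt)

    peak before after : Fin (suc k)
    peak   = proj₁ deepest-spec
    before = proj₁ (prev peak)
    after  = proj₁ (next peak)

    before↝ : before ↝ peak
    before↝ = proj₂ (prev peak)

    ↝after : peak ↝ after
    ↝after = proj₂ (next peak)

    before≢after : before ≢ after
    before≢after eq =
      contradiction (↝-round₂ ↝after (subst (_↝ peak) eq before↝)) (<⇒≱ (<⇒≤ (s≤s⁻¹ 4≤k)))

    contains : ∀ {j} → Adj (complement G) (at peak) (at j) → apex (ix peak) ∈ Subtree.nodes (F (ix j))
    contains {j} ij = proj₂ (deeper-top {F (ix peak)} {F (ix j)} (meets {peak} {j} ij)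
      (proj₂ (proj₂ deepest-spec) tt))

-- Transport along an isomorphism

module Pullback {k m} {G : Graph k} {D : Graph m} (iso : G ≅ D) where
  open _≅_ iso

  image : ∀ {u} → u ∈ vertices G → Fin m
  image {u} u∈ = proj₁ (to (u , u∈))

  -- An isomorphism acts on vertices paired with membership proofs, so these are part of the
  -- relation; proof irrelevance makes the images independent of them.
  lift : Rel (Fin m) 0ℓ → Rel (Fin k) 0ℓ
  lift R u v = Σ (u ∈ vertices G) λ u∈ → Σ (v ∈ vertices G) λ v∈ → R (image u∈) (image v∈)

  pull : Graph m → Graph k
  pull H = record
    { vertices = vertices G
    ; Adj      = lift (Adj H)
    ; adj?     = dec
    ; symm     = λ (u∈ , v∈ , uv) → v∈ , u∈ , symm H uv
    ; irrefl   = irr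
    ; incident = proj₁
    }
    where
    dec : Decidable (lift (Adj H))
    dec u v with u ∈? vertices G | v ∈? vertices G
    ... | no u∉  | _      = no (u∉ ∘ proj₁)
    ... | yes _  | no v∉  = no (v∉ ∘ proj₁ ∘ proj₂)
    ... | yes u∈ | yes v∈ = map′ (λ uv → u∈ , v∈ , uv)
      (λ (u∈′ , v∈′ , uv) → subst₂ (λ p q → Adj H (image p) (image q))
                              ([]=-irrelevant u∈′ u∈) ([]=-irrelevant v∈′ v∈) uv)
      (adj? H (image u∈) (image v∈))

    irr : ∀ {v} → ¬ lift (Adj H) v v
    irr (p , q , vv) with refl ← []=-irrelevant p q = irrefl H vv

  pull-comparability : ∀ {H} → IsComparability H → IsComparability (pull H)
  pull-comparability {H} (_⟶_ , orientation) = lift _⟶_ , record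
    { sound    = λ (p , q , uv) → p , q , sound uv
    ; complete = λ (p , q , uv) → Sum.map (λ r → p , q , r) (λ r → q , p , r) (complete uv)
    ; asym     = asymmetric
    ; trans    = transitive
    }
    where
    open IsTransitiveOrientation orientation renaming (trans to ⟶-trans)
    asymmetric : ∀ {u v} → lift _⟶_ u v → ¬ lift _⟶_ v u
    asymmetric (p , q , uv) (q′ , p′ , vu)
      with refl ← []=-irrelevant p p′ | refl ← []=-irrelevant q q′ = asym uv vu

    transitive : Transitive (lift _⟶_)
    transitive (p , q , uv) (q′ , r , vw) with refl ← []=-irrelevant q q′ = p , r , ⟶-trans uv vw

  pull-partition : ∀ {c} → ComparabilityPartition D c → ComparabilityPartition G c
  pull-partition P = record
    { cover = record
      { part          = pull ∘ part
      ; subgraph      = λ i → record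
        { vertices⊆ = id
        ; adj⊆      = λ (u∈ , v∈ , uv) →
                        Equivalence.from (adj⇔ (_ , u∈) (_ , v∈)) (_⊑_.adj⊆ (subgraph i) uv)
        }
      ; comparability = λ i → pull-comparability {part i} (comparability i)
      ; covers        = λ uv → cover-lift (incident G uv) (neighbour∈ G uv) uv
      }
    ; edgeDisjoint = disjoint
    }
    where
    open ComparabilityPartition P

    cover-lift : ∀ {u v} → u ∈ vertices G → v ∈ vertices G → Adj G u v →
                 ∃ λ i → lift (Adj (part i)) u v
    cover-lift u∈ v∈ uv with i , e ← covers (Equivalence.to (adj⇔ (_ , u∈) (_ , v∈)) uv) =
      i , u∈ , v∈ , e

    disjoint : ∀ {i j} → i ≢ j → ∀ {u v} → lift (Adj (part i)) u v → ¬ lift (Adj (part j)) u v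
    disjoint i≢j (p , q , e) (p′ , q′ , e′)
      with refl ← []=-irrelevant p p′ | refl ← []=-irrelevant q q′ = edgeDisjoint i≢j e e′

-- The values of c and p

module _ {n} {P : Fin n → Set} (P? : U.Decidable P) where

  comprehension : Subset n
  comprehension = tabulate (does ∘ P?)

  ∈-comprehension⁺ : ∀ {x} → P x → x ∈ comprehension
  ∈-comprehension⁺ {x} Px = lookup⇒[]= x _ (trans (lookup∘tabulate _ x) (dec-true (P? x) Px))

  ∈-comprehension⁻ : ∀ {x} → x ∈ comprehension → P x
  ∈-comprehension⁻ {x} x∈ = witness (P? x) (trans (sym (lookup∘tabulate _ x)) ([]=⇒lookup x∈))
    where
    witness : ∀ {A : Set} (A? : Dec A) → does A? ≡ true → A
    witness (yes a) _ = a

module _ {n} (G : Graph n) where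

  private
    transitiveOrientation? : ∀ {_⟶_ : Rel (Fin n) 0ℓ} →
                             Decidable _⟶_ → Dec (IsTransitiveOrientation G _⟶_)
    transitiveOrientation? ⟶? = map′
      (λ (s , c , a , t) → record { sound = s _ _ ; complete = c _ _ ; asym = a _ _ ; trans = t _ _ _ })
      (λ o → let open IsTransitiveOrientation o renaming (trans to ⟶-trans) in
         (λ _ _ → sound) , (λ _ _ → complete) , (λ _ _ → asym) , (λ _ _ _ → ⟶-trans))
      (all? (λ u → all? λ v → ⟶? u v →-dec adj? G u v)
       ×-dec all? (λ u → all? λ v → adj? G u v →-dec (⟶? u v ⊎-dec ⟶? v u))
       ×-dec all? (λ u → all? λ v → ⟶? u v →-dec ¬? (⟶? v u))
       ×-dec all? (λ u → all? λ v → all? λ w → ⟶? u v →-dec (⟶? v w →-dec ⟶? u w)))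

    -- Relations are coded as subsets of a finite set of pairs, so that all candidate orientations
    -- can be searched.
    decode : Subset (n * n) → Rel (Fin n) 0ℓ
    decode s u v = combine u v ∈ s

  -- On an edge, `complete` yields one direction and `asym` refutes the other.
  orientation-decidable : ∀ {_⟶_ : Rel (Fin n) 0ℓ} → IsTransitiveOrientation G _⟶_ → Decidable _⟶_
  orientation-decidable o u v with adj? G u v
  ... | no ¬uv = no (¬uv ∘ IsTransitiveOrientation.sound o)
  ... | yes uv with IsTransitiveOrientation.complete o uv
  ...   | inj₁ u⟶v = yes u⟶v
  ...   | inj₂ v⟶u = no (IsTransitiveOrientation.asym o v⟶u)

  private
    encode : ∀ {_⟶_ : Rel (Fin n) 0ℓ} → IsTransitiveOrientation G _⟶_ →
             ∃ λ s → IsTransitiveOrientation G (decode s)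
    encode {_⟶_} o = s , record
      { sound    = sound ∘ ∈s⁻
      ; complete = Sum.map ∈s⁺ ∈s⁺ ∘ complete
      ; asym     = λ uv vu → asym (∈s⁻ uv) (∈s⁻ vu)
      ; trans    = λ uv vw → ∈s⁺ (⟶-trans (∈s⁻ uv) (∈s⁻ vw))
      }
      where
      open IsTransitiveOrientation o renaming (trans to ⟶-trans)

      P? : U.Decidable λ e → proj₁ (remQuot {n} n e) ⟶ proj₂ (remQuot {n} n e)
      P? e = orientation-decidable o _ _

      s : Subset (n * n)
      s = comprehension P?

      ∈s⁺ : ∀ {u v} → u ⟶ v → decode s u v
      ∈s⁺ {u} {v} uv = ∈-comprehension⁺ P?
        (subst (λ (a , b) → a ⟶ b) (sym (remQuot-combine u v)) uv)

      ∈s⁻ : ∀ {u v} → decode s u v → u ⟶ v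
      ∈s⁻ {u} {v} uv = subst (λ (a , b) → a ⟶ b) (remQuot-combine u v) (∈-comprehension⁻ P? uv)

  comparability? : Dec (IsComparability G)
  comparability? = map′ (λ (s , o) → decode s , o) (encode ∘ proj₂)
    (anySubset? λ s → transitiveOrientation? λ u v → combine u v ∈? s)

  edge? : Dec (∃₂ λ u v → Adj G u v)
  edge? = any? λ u → any? λ v → adj? G u v

  edgeless-partition : ¬ (∃₂ λ u v → Adj G u v) → ComparabilityPartition G 0
  edgeless-partition ¬edge = record
    { cover = record
      { part          = λ ()
      ; subgraph      = λ ()
      ; comparability = λ ()
      ; covers        = λ uv → contradiction (_ , _ , uv) ¬edge
      }
    ; edgeDisjoint = λ { {()} }
    }

  comparability-partition : IsComparability G → ComparabilityPartition G 1
  comparability-partition comparability = record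
    { cover = record
      { part          = λ _ → G
      ; subgraph      = λ _ → record { vertices⊆ = id ; adj⊆ = id }
      ; comparability = λ _ → comparability
      ; covers        = zero ,_
      }
    ; edgeDisjoint = λ { {zero} {zero} 0≢0 → contradiction refl 0≢0 }
    }

  cover-nonempty : (∃₂ λ u v → Adj G u v) → ∀ {c} → ComparabilityCover G c → 1 ≤ c
  cover-nonempty (_ , _ , uv) {zero} C with () ← proj₁ (ComparabilityCover.covers C uv)
  cover-nonempty _ {suc c} _ = s≤s z≤n

  cover-one : ComparabilityCover G 1 → IsComparability G
  cover-one C with ⟶ , o ← ComparabilityCover.comparability C zero = ⟶ , record
    { sound    = _⊑_.adj⊆ (subgraph zero) ∘ sound
    ; complete = complete ∘ in₀
    ; asym     = asym
    ; trans    = ⟶-trans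
    }
    where
    open ComparabilityCover C
    open IsTransitiveOrientation o renaming (trans to ⟶-trans)
    in₀ : ∀ {u v} → Adj G u v → Adj (part zero) u v
    in₀ uv with zero , e ← covers uv = e

  -- With two parts available, the minima are 0, 1 or 2, settled by deciding whether there is an
  -- edge and whether `G` is a comparability graph. Partitions are covers, so each lower bound for
  -- covers serves both parameters.
  parameters : ComparabilityPartition G 2 → ∃₂ λ c p → IsC G c × IsP G p × c ≤ p × p ≤ 2
  parameters P₂ with edge?
  ... | no ¬edge = 0 , 0 , (cover P , λ _ → z≤n) , (P , λ _ → z≤n) , z≤n , z≤n
    where
    open ComparabilityPartition using (cover)
    P = edgeless-partition ¬edge
  ... | yes edge with comparability?
  ...   | yes comparability = 1 , 1 , (cover P , cover-nonempty edge) ,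
                              (P , cover-nonempty edge ∘ cover) , ≤-refl , s≤s z≤n
    where
    open ComparabilityPartition using (cover)
    P = comparability-partition comparability
  ...   | no ¬comparability = 2 , 2 , (cover P₂ , two) , (P₂ , two ∘ cover) , ≤-refl , ≤-refl
    where
    open ComparabilityPartition using (cover)
    two : ∀ {c} → ComparabilityCover G c → 2 ≤ c
    two {0}           C = contradiction (cover-nonempty edge C) λ ()
    two {1}           C = contradiction (cover-one C) ¬comparability
    two {suc (suc _)} _ = s≤s (s≤s z≤n)

-- Perfect elimination orderings

x∉p-x : ∀ {n} (p : Subset n) x → x ∉ p - x
x∉p-x (_ ∷ p) (suc x) (there x∈) = x∉p-x p x x∈

module Elimination {n} (H : Graph n) (chordal : IsChordal H) where

  Simplicial : Subset n → Fin n → Set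
  Simplicial W v = v ∈ W × (∀ {x y} → x ∈ W → y ∈ W → Adj H v x → Adj H v y → x ≢ y → Adj H x y)

  Touches : Subset n → Fin n → Set
  Touches A x = ∃ λ a → a ∈ A × Adj H x a

  touches? : ∀ A → U.Decidable (Touches A)
  touches? A x = any? λ a → (a ∈? A) ×-dec adj? H x a

  ConnectedFrom : Fin n → Subset n → Set
  ConnectedFrom v A = ∀ {a} → a ∈ A → Star (Within H (_∈ A)) v a

  -- Otherwise a shortest path from x to y through A, closed up by b, is a chordless cycle.
  neighbours-joined : ∀ {v A b x y} → ConnectedFrom v A → b ∉ A → ¬ Touches A b →
    Touches A x → Touches A y → Adj H b x → Adj H b y → x ≢ y → Adj H x y
  neighbours-joined {v} {A} {b} {x} {y} connected b∉A b∤A (a , a∈ , xa) (c , c∈ , yc) bx by x≢y =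
    decidable-stable (adj? H x y) λ ¬xy → refute ¬xy (inducedPath (within? H P P?) walk)
    where
    P : Fin n → Set
    P u = u ∈ A ⊎ (u ≡ x ⊎ u ≡ y)

    P? : U.Decidable P
    P? u = (u ∈? A) ⊎-dec ((u ≟ᶠ x) ⊎-dec (u ≟ᶠ y))

    walk : Star (Within H P) x y
    walk = (xa , inj₂ (inj₁ refl) , inj₁ a∈) ◅
           Star.map (λ (uw , u∈ , w∈) → uw , inj₁ u∈ , inj₁ w∈)
             (Star.reverse (within-sym H (_∈ A)) (connected a∈) ◅◅ connected c∈) ◅◅
           (symm H yc , inj₁ c∈ , inj₂ (inj₂ refl)) ◅ ε

    ¬Pb : ¬ P b
    ¬Pb (inj₁ b∈)          = b∉A b∈
    ¬Pb (inj₂ (inj₁ refl)) = irrefl H bx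
    ¬Pb (inj₂ (inj₂ refl)) = irrefl H by

    refute : ¬ Adj H x y → ¬ (∃ λ zs → Induced (Within H P) x zs y)
    refute ¬xy (zs , path) = ¬chord (chordal C (long path))
      where
      C = closePath H P ¬Pb (inj₂ (inj₁ refl)) bx by x≢y path

      long : ∀ {zs} → Induced (Within H P) x zs y → 4 ≤ suc (suc (length zs))
      long [-]                      = contradiction refl x≢y
      long (((xy , _) , _) ∷ [-])   = contradiction xy ¬xy
      long (_ ∷ (_ ∷ _))            = s≤s (s≤s (s≤s (s≤s z≤n)))

      inP : ∀ i → P (lookup (x ∷ zs) i)
      inP = induced-inside H P (inj₂ (inj₁ refl)) path

      -- The path runs through `A`, `x` and `y`, and `b` has no neighbour in `A`; this excludes
      -- chords at `b`.
      ends : ∀ i → Adj H b (lookup (x ∷ zs) i) → i ≡ zero ⊎ i ≡ fromℕ (length zs)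
      ends i bi with inP i
      ... | inj₁ i∈        = contradiction (_ , i∈ , bi) b∤A
      ... | inj₂ (inj₁ eq) = inj₁ (induced-distinct path i zero eq)
      ... | inj₂ (inj₂ eq) = inj₂ (induced-distinct path i (fromℕ _) (trans eq (sym (induced-last path))))

      consecutive⇒↝ : ∀ {k} {i j : Fin (suc k)} → Consecutive i j → suc i ↝ suc j
      consecutive⇒↝ (m , refl , refl) = step (suc m)

      ¬chord : ¬ Chord C
      ¬chord record { i = i ; j = j ; ¬edgeᵢⱼ = ¬ij ; ¬edgeⱼᵢ = ¬ji ; chord = ij } = go i j ¬ij ¬ji ij
        where
        open Cycle C
        go : ∀ i j → ¬ i ↝ j → ¬ j ↝ i → ¬ Adj H (at i) (at j)
        go zero zero _ _ bb = irrefl H bb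
        go zero (suc j) ¬0j ¬j0 bj with ends j bj
        ... | inj₁ refl = ¬0j (step zero)
        ... | inj₂ refl = ¬j0 wrap
        go (suc i) zero ¬i0 ¬0i ib with ends i (symm H ib)
        ... | inj₁ refl = ¬0i (step zero)
        ... | inj₂ refl = ¬i0 wrap
        go (suc i) (suc j) ¬ij ¬ji ij =
          Sum.[ ¬ij ∘ consecutive⇒↝ , ¬ji ∘ consecutive⇒↝ ]
            (induced-chordless (within-sym H P) path i j (λ { refl → irrefl H ij })
              (ij , inP i , inP j))

  module _ (W : Subset n) where

    Beyond : Subset n → Fin n → Set
    Beyond A b = b ∈ W × b ∉ A × ¬ Touches A b

    beyond? : ∀ A → U.Decidable (Beyond A)
    beyond? A b = (b ∈? W) ×-dec (¬? (b ∈? A) ×-dec ¬? (touches? A b))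

    record Core (v : Fin n) (A : Subset n) : Set where
      field
        v∈A       : v ∈ A
        connected : ConnectedFrom v A
        beyond    : ∃ (Beyond A)

    Saturated : Subset n → Set
    Saturated A = ∀ {x b} → x ∈ W → x ∉ A → Touches A x → Beyond A b → Adj H x b

    -- A neighbour `x` of `A` not adjacent to some `b` beyond `A` can be added: `A` stays connected
    -- and `b` stays beyond it. The growth stops because there are finitely many vertices.
    saturate : ∀ {v A} → Acc _⊃_ A → Core v A → ∃ λ A → Core v A × Saturated A
    saturate {v} {A} (acc rs) core
      with any? (λ x → any? λ b → ((x ∈? W) ×-dec (¬? (x ∈? A) ×-dec touches? A x))
                                 ×-dec (beyond? A b ×-dec ¬? (adj? H x b)))
    ... | no ¬∃ = A , core , λ {x} {b} x∈ x∉ xA bB →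
      decidable-stable (adj? H x b) λ ¬xb → ¬∃ (x , b , (x∈ , x∉ , xA) , bB , ¬xb)
    ... | yes (x , b , (x∈ , x∉ , a , a∈ , xa) , (b∈ , b∉ , b∤A) , ¬xb) =
      saturate (rs A⊂A′) record
        { v∈A       = A⊆A′ v∈A
        ; connected = connected′
        ; beyond    = b , b∈ , b∉A′ , b∤A′
        }
      where
      open Core core
      A′ : Subset n
      A′ = A ∪ ⁅ x ⁆

      A⊆A′ : A ⊆ A′
      A⊆A′ = p⊆p∪q ⁅ x ⁆

      x∈A′ : x ∈ A′
      x∈A′ = q⊆p∪q A ⁅ x ⁆ (x∈⁅x⁆ x)

      A⊂A′ : A ⊂ A′
      A⊂A′ = A⊆A′ , x , x∈A′ , x∉

      split : ∀ {u} → u ∈ A′ → u ∈ A ⊎ u ≡ x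
      split u∈ = Sum.map id (x∈⁅y⁆⇒x≡y x) (x∈p∪q⁻ A ⁅ x ⁆ u∈)

      widen : ∀ {u} → u ∈ A → Star (Within H (_∈ A′)) v u
      widen u∈ = Star.map (λ (uw , u∈ , w∈) → uw , A⊆A′ u∈ , A⊆A′ w∈) (connected u∈)

      connected′ : ConnectedFrom v A′
      connected′ u∈ with split u∈
      ... | inj₁ u∈A  = widen u∈A
      ... | inj₂ refl = widen a∈ ◅◅ (symm H xa , A⊆A′ a∈ , x∈A′) ◅ ε

      b∉A′ : b ∉ A′
      b∉A′ b∈A′ with split b∈A′
      ... | inj₁ b∈A  = b∉ b∈A
      ... | inj₂ refl = b∤A (a , a∈ , xa)

      b∤A′ : ¬ Touches A′ b
      b∤A′ (c , c∈ , bc) with split c∈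
      ... | inj₁ c∈A  = b∤A (c , c∈A , bc)
      ... | inj₂ refl = ¬xb (symm H bc)

  -- Unless v is adjacent to all of W, let A ∋ v be a connected set saturated in W. What lies
  -- beyond A is completely joined to the neighbours of A, and these form a clique,
  -- so a simplicial vertex beyond A stays simplicial in W.
  simplicial : ∀ {W} → Acc _⊂_ W → Nonempty W → ∃ (Simplicial W)
  simplicial {W} (acc rs) (v , v∈) with any? (λ w → (w ∈? W) ×-dec (¬? (w ≟ᶠ v) ×-dec ¬? (adj? H v w)))
  ... | no ¬∃ = universal (nonempty? (W - v))
    where
    joined : ∀ {w} → w ∈ W → w ≢ v → Adj H v w
    joined {w} w∈ w≢v = decidable-stable (adj? H v w) λ ¬vw → ¬∃ (w , w∈ , w≢v , ¬vw)

    -- Being adjacent to all of `W`, the vertex `v` spoils no clique when it is put back; if nothing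
    -- else is left, `v` itself is simplicial.
    universal : Dec (Nonempty (W - v)) → ∃ (Simplicial W)
    universal (no empty) = v , v∈ , λ x∈ _ vx _ _ →
      contradiction (_ , x∈p∧x≢y⇒x∈p-y x∈ λ { refl → irrefl H vx }) empty
    universal (yes ne) with u , u∈ , clique ← simplicial (rs (x∈p⇒p-x⊂p v∈)) ne =
      u , p─q⊆p W ⁅ v ⁆ u∈ , clique′
      where
      clique′ : ∀ {x y} → x ∈ W → y ∈ W → Adj H u x → Adj H u y → x ≢ y → Adj H x y
      clique′ {x} {y} x∈ y∈ ux uy x≢y with x ≟ᶠ v | y ≟ᶠ v
      ... | yes refl | _        = joined y∈ (x≢y ∘ sym)
      ... | no _     | yes refl = symm H (joined x∈ x≢y)
      ... | no x≢v   | no y≢v   = clique (x∈p∧x≢y⇒x∈p-y x∈ x≢v) (x∈p∧x≢y⇒x∈p-y y∈ y≢v) ux uy x≢y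
  ... | yes (w , w∈ , w≢v , ¬vw)
    with A , core , saturated ← saturate W (⊃-wellFounded ⁅ v ⁆) record
      { v∈A       = x∈⁅x⁆ v
      ; connected = λ a∈ → subst (Star _ v) (sym (x∈⁅y⁆⇒x≡y v a∈)) ε
      ; beyond    = w , w∈ , x≢y⇒x∉⁅y⁆ w≢v ,
                    λ (a , a∈ , wa) → ¬vw (symm H (subst (Adj H w) (x∈⁅y⁆⇒x≡y v a∈) wa))
      }
    = beyondSimplicial
    where
    open Core core

    B : Subset n
    B = comprehension (beyond? W A)

    ∈B⁻ : ∀ {b} → b ∈ B → Beyond W A b
    ∈B⁻ = ∈-comprehension⁻ (beyond? W A)

    ∈B⁺ : ∀ {b} → Beyond W A b → b ∈ B
    ∈B⁺ = ∈-comprehension⁺ (beyond? W A)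

    B⊂W : B ⊂ W
    B⊂W = proj₁ ∘ ∈B⁻ , v , v∈ , λ v∈B → proj₁ (proj₂ (∈B⁻ v∈B)) v∈A

    beyondSimplicial : ∃ (Simplicial W)
    beyondSimplicial with u , u∈B , clique ← simplicial (rs B⊂W) (_ , ∈B⁺ (proj₂ beyond)) =
      u , proj₁ (∈B⁻ u∈B) , clique′
      where
      u∉A : u ∉ A
      u∉A = proj₁ (proj₂ (∈B⁻ u∈B))

      u∤A : ¬ Touches A u
      u∤A = proj₂ (proj₂ (∈B⁻ u∈B))

      notInA : ∀ {x} → Adj H u x → x ∉ A
      notInA ux x∈A = u∤A (_ , x∈A , ux)

      clique′ : ∀ {x y} → x ∈ W → y ∈ W → Adj H u x → Adj H u y → x ≢ y → Adj H x y
      -- A neighbour of `u` is outside `A`, so it either touches `A` or lies beyond it. Saturation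
      -- settles the mixed pairs, the recursive call the pairs beyond.
      clique′ {x} {y} x∈ y∈ ux uy x≢y with touches? A x | touches? A y
      ... | yes xA | yes yA = neighbours-joined connected u∉A u∤A xA yA ux uy x≢y
      ... | yes xA | no y∤A = saturated x∈ (notInA ux) xA (y∈ , notInA uy , y∤A)
      ... | no x∤A | yes yA = symm H (saturated y∈ (notInA uy) yA (x∈ , notInA ux , x∤A))
      ... | no x∤A | no y∤A = clique (∈B⁺ (x∈ , notInA ux , x∤A)) (∈B⁺ (y∈ , notInA uy , y∤A)) ux uy x≢y

  -- Vertices of higher rank are eliminated first.
  record Ordering (W : Subset n) : Set where
    field
      rank      : Fin n → ℕ
      bound     : ℕ
      rank<     : ∀ u → rank u < bound
      injective : ∀ {u v} → u ∈ W → v ∈ W → rank u ≡ rank v → u ≡ v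
      perfect   : ∀ {v x y} → v ∈ W → x ∈ W → y ∈ W → Adj H v x → Adj H v y →
                  rank x < rank v → rank y < rank v → x ≢ y → Adj H x y

  -- A simplicial vertex `s` is ranked above all the others. Then `perfect` at `s` is simpliciality,
  -- and at any other vertex `s` has too high a rank to occur.
  ordering : ∀ {W} → Acc _⊂_ W → Ordering W
  ordering {W} (acc rs) with nonempty? W
  ... | no empty = record
    { rank      = λ _ → 0
    ; bound     = 1
    ; rank<     = λ _ → s≤s z≤n
    ; injective = λ u∈ → contradiction (_ , u∈) empty
    ; perfect   = λ v∈ → contradiction (_ , v∈) empty
    }
  ... | yes ne with s , s∈ , clique ← simplicial (⊂-wellFounded W) ne = record
    { rank      = rank
    ; bound     = suc bound
    ; rank<     = λ u → s≤s (rank≤ u)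
    ; injective = injective
    ; perfect   = perfect
    }
    where
    module Rest = Ordering (ordering (rs (x∈p⇒p-x⊂p s∈)))
    open Rest using (bound)

    rank : Fin n → ℕ
    rank u with u ≟ᶠ s
    ... | yes _ = bound
    ... | no _  = Rest.rank u

    rank≤ : ∀ u → rank u ≤ bound
    rank≤ u with u ≟ᶠ s
    ... | yes _ = ≤-refl
    ... | no _  = <⇒≤ (Rest.rank< u)

    rest : ∀ {u} → u ∈ W → u ≢ s → u ∈ W - s
    rest = x∈p∧x≢y⇒x∈p-y

    injective : ∀ {u v} → u ∈ W → v ∈ W → rank u ≡ rank v → u ≡ v
    injective {u} {v} u∈ v∈ eq with u ≟ᶠ s | v ≟ᶠ s
    ... | yes refl | yes refl = refl
    ... | yes _    | no _     = contradiction (Rest.rank< v) (<-irrefl (sym eq))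
    ... | no _     | yes _    = contradiction (Rest.rank< u) (<-irrefl eq)
    ... | no u≢s   | no v≢s   = Rest.injective (rest u∈ u≢s) (rest v∈ v≢s) eq

    perfect : ∀ {v x y} → v ∈ W → x ∈ W → y ∈ W → Adj H v x → Adj H v y →
              rank x < rank v → rank y < rank v → x ≢ y → Adj H x y
    perfect {v} {x} {y} v∈ x∈ y∈ vx vy x<v y<v x≢y with v ≟ᶠ s
    ... | yes refl = clique x∈ y∈ vx vy x≢y
    ... | no v≢s with x ≟ᶠ s | y ≟ᶠ s
    ...   | yes _  | _      = contradiction x<v (<-asym (Rest.rank< v))
    ...   | no _   | yes _  = contradiction y<v (<-asym (Rest.rank< v))
    ...   | no x≢s | no y≢s = Rest.perfect (rest v∈ v≢s) (rest x∈ x≢s) (rest y∈ y≢s) vx vy x<v y<v x≢y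

-- The tree of an ordering

private
  shift : ∀ {n s} {p : Subset n} → ∃ (_∈ p) → ∃ (_∈ (s ∷ p))
  shift (x , x∈) = suc x , there x∈

-- Vertices of `G` form a subset, whereas a family of subtrees is indexed by a full `Fin`; `element`
-- and `index` translate between the two.
element : ∀ {n} (p : Subset n) → Fin ∣ p ∣ → ∃ (_∈ p)
element (outside ∷ p) j       = shift (element p j)
element (inside  ∷ p) zero    = zero , here
element (inside  ∷ p) (suc j) = shift (element p j)

index : ∀ {n} (p : Subset n) → ∃ (_∈ p) → Fin ∣ p ∣
index (inside  ∷ p) (zero  , here)     = zero
index (inside  ∷ p) (suc x , there x∈) = suc (index p (x , x∈))
index (outside ∷ p) (suc x , there x∈) = index p (x , x∈)

index-element : ∀ {n} (p : Subset n) j → index p (element p j) ≡ j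
index-element (outside ∷ p) j       = index-element p j
index-element (inside  ∷ p) zero    = refl
index-element (inside  ∷ p) (suc j) = cong suc (index-element p j)

element-index : ∀ {n} (p : Subset n) x → element p (index p x) ≡ x
element-index (inside  ∷ p) (zero  , here)     = refl
element-index (inside  ∷ p) (suc x , there x∈) = cong shift (element-index p (x , x∈))
element-index (outside ∷ p) (suc x , there x∈) = cong shift (element-index p (x , x∈))

-- The tree has the vertices suc v and an extra root zero.
module Representation {k} (G : Graph k) (chordal : IsChordal (complement G)) where

  private
    H : Graph k
    H = complement G

    V : Subset k
    V = vertices G

  open Elimination.Ordering (Elimination.ordering H chordal (⊂-wellFounded V))

  Later : Rel (Fin k) 0ℓ
  Later u w = Adj H u w × rank w < rank u

  later? : Decidable Later
  later? u w = adj? H u w ×-dec (rank w <? rank u)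

  later-joined : ∀ {u v w} → Later u v → Later u w → v ≢ w → Adj H v w
  later-joined (uv , v<u) (uw , w<u) =
    perfect (incident H uv) (neighbour∈ H uv) (neighbour∈ H uw) uv uw v<u w<u

  -- Elimination runs by decreasing rank, so the nearest later neighbour is the one of largest rank.
  data ParentSpec (u : Fin k) : Fin (suc k) → Set where
    orphan : ¬ ∃ (Later u) → ParentSpec u zero
    child  : ∀ {w} → Later u w → (∀ {x} → Later u x → rank x ≤ rank w) → ParentSpec u (suc w)

  parentSpec : ∀ u → ∃ (ParentSpec u)
  parentSpec u with any? (later? u)
  ... | no ¬∃ = zero , orphan ¬∃
  ... | yes ∃w with w , uw , nearest ← argmax rank (later? u) ∃w = suc w , child uw nearest

  Child : Rel (Fin (suc k)) 0ℓ
  Child zero    _ = ⊥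
  Child (suc u) y = y ≡ proj₁ (parentSpec u)

  child? : Decidable Child
  child? zero    _ = no λ ()
  child? (suc u) y = y ≟ᶠ proj₁ (parentSpec u)

  child-unique : ∀ {x y z} → Child x y → Child x z → y ≡ z
  child-unique {suc u} p q = trans p (sym q)

  depth : Fin (suc k) → ℕ
  depth zero    = 0
  -- The shift keeps the extra root strictly above a vertex of rank 0.
  depth (suc u) = suc (rank u)

  child-depth : ∀ {x y} → Child x y → depth y < depth x
  child-depth {suc u} refl with parentSpec u
  ... | _ , orphan _          = s≤s z≤n
  ... | _ , child (_ , w<u) _ = s≤s w<u

  treeOn : Subset (suc k) → Graph (suc k)
  treeOn S = record
    { vertices = S
    ; Adj      = λ x y → (x ∈ S × y ∈ S) × (Child x y ⊎ Child y x)
    ; adj?     = λ x y → ((x ∈? S) ×-dec (y ∈? S)) ×-dec (child? x y ⊎-dec child? y x)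
    ; symm     = λ ((x∈ , y∈) , c) → (y∈ , x∈) , Sum.swap c
    ; irrefl   = λ (_ , c) → <-irrefl refl (child-depth (Sum.reduce c))
    ; incident = proj₁ ∘ proj₁
    }

  -- `Child` is functional and lowers `depth`, so a neighbour that is not deeper must be the parent.
  -- This serves the whole tree and the clusters alike.
  treeOn-isTree : ∀ {S r} → r ∈ S → (∀ {x} → x ∈ S → x ≢ r → ∃ λ y → Child x y × y ∈ S) →
                  IsTree (treeOn S)
  treeOn-isTree {S} {r} r∈ parent = rooted⇒isTree record
    { root   = r
    ; root∈  = r∈
    ; depth  = depth
    ; unique = λ (_ , c) (_ , c′) y≤x z≤x → child-unique (down c y≤x) (down c′ z≤x)
    ; ascend = ascend (<-wellFounded _)
    }
    where
    down : ∀ {x y} → Child x y ⊎ Child y x → depth y ≤ depth x → Child x y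
    down (inj₁ c) _   = c
    down (inj₂ c) y≤x = contradiction (child-depth c) (≤⇒≯ y≤x)

    ascend : ∀ {x} → Acc _<_ (depth x) → x ∈ S →
             Star (λ x y → Adj (treeOn S) x y × depth y < depth x) x r
    ascend {x} (acc rs) x∈ with x ≟ᶠ r
    ... | yes refl = ε
    ... | no x≢r with y , c , y∈ ← parent x∈ x≢r =
      (((x∈ , y∈) , inj₁ c) , child-depth c) ◅ ascend (rs (child-depth c)) y∈

  T : Graph (suc k)
  T = treeOn full

  T-isTree : IsTree T
  T-isTree = treeOn-isTree {r = zero} ∈⊤ λ
    { {zero}  _ 0≢0 → contradiction refl 0≢0
    ; {suc u} _ _   → _ , refl , ∈⊤
    }

  InCluster : Fin k → Fin (suc k) → Set
  InCluster v zero    = ⊥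
  InCluster v (suc u) = u ≡ v ⊎ Later u v

  inCluster? : ∀ v → U.Decidable (InCluster v)
  inCluster? v zero    = no λ ()
  inCluster? v (suc u) = (u ≟ᶠ v) ⊎-dec later? u v

  cluster : Fin k → Subset (suc k)
  cluster v = comprehension (inCluster? v)

  ∈cluster⁺ : ∀ {v x} → InCluster v x → x ∈ cluster v
  ∈cluster⁺ {v} = ∈-comprehension⁺ (inCluster? v)

  ∈cluster⁻ : ∀ {v x} → x ∈ cluster v → InCluster v x
  ∈cluster⁻ {v} = ∈-comprehension⁻ (inCluster? v)

  clusterSubtree : Fin k → Subtree T
  clusterSubtree v = record
    { graph    = treeOn (cluster v)
    ; subgraph = record { vertices⊆ = λ _ → ∈⊤ ; adj⊆ = λ (_ , c) → (∈⊤ , ∈⊤) , c }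
    ; isTree   = treeOn-isTree (∈cluster⁺ (inj₁ refl)) (λ x∈ → parent (∈cluster⁻ x∈))
    }
    where
    -- The parent of u is its nearest later neighbour, hence v itself or a neighbour of v before v.
    parent : ∀ {x} → InCluster v x → x ≢ suc v → ∃ λ y → Child x y × y ∈ cluster v
    parent {suc u} (inj₁ refl) u≢u = contradiction refl u≢u
    parent {suc u} (inj₂ uv) _ with parentSpec u
    ... | _ , orphan none = contradiction (v , uv) none
    ... | suc w , child uw nearest with w ≟ᶠ v
    ...   | yes w≡v = suc w , refl , ∈cluster⁺ (inj₁ w≡v)
    -- Both are later neighbours of `u`, hence adjacent; `w` is the nearest and ranks are injective,
    -- so `v` comes strictly after `w`.
    ...   | no w≢v  = suc w , refl , ∈cluster⁺ (inj₂ (later-joined uw uv w≢v ,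
      ≤∧≢⇒< (nearest uv) λ eq →
        w≢v (sym (injective (neighbour∈ H (proj₁ uv)) (neighbour∈ H (proj₁ uw)) eq))))

  later⇒meet : ∀ {u v} → Later u v → ¬ Empty (cluster u ∩ cluster v)
  later⇒meet {u} uv empty = empty (suc u , x∈p∩q⁺ (∈cluster⁺ (inj₁ refl) , ∈cluster⁺ (inj₂ uv)))

  later⇒meet′ : ∀ {u v} → Later v u → ¬ Empty (cluster u ∩ cluster v)
  later⇒meet′ {v = v} vu empty = empty (suc v , x∈p∩q⁺ (∈cluster⁺ (inj₂ vu) , ∈cluster⁺ (inj₁ refl)))

  -- A common vertex of the clusters is `u`, `v` or an earlier neighbour of both, and in the last
  -- case perfectness joins `u` and `v` in the complement. Conversely, of two vertices adjacent in
  -- the complement, the earlier lies in both clusters.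
  adj⇔disjoint : ∀ {u v} → u ∈ V → v ∈ V → Adj G u v ⇔ Empty (cluster u ∩ cluster v)
  adj⇔disjoint {u} {v} u∈ v∈ = mk⇔ disjoint adjacent
    where
    disjoint : Adj G u v → Empty (cluster u ∩ cluster v)
    disjoint uv (x , x∈) with x∈u , x∈v ← x∈p∩q⁻ _ _ x∈ =
      apart x (∈cluster⁻ x∈u) (∈cluster⁻ x∈v)
      where
      apart : ∀ x → InCluster u x → ¬ InCluster v x
      apart (suc w) (inj₁ refl) (inj₁ refl)              = irrefl G uv
      apart (suc w) (inj₁ refl) (inj₂ ((_ , _ , ¬uv) , _)) = ¬uv uv
      apart (suc w) (inj₂ ((_ , _ , ¬vu) , _)) (inj₁ refl) = ¬vu (symm G uv)
      apart (suc w) (inj₂ wu) (inj₂ wv) with u ≟ᶠ v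
      ... | yes refl = irrefl G uv
      ... | no u≢v   = proj₂ (proj₂ (later-joined wu wv u≢v)) uv

    adjacent : Empty (cluster u ∩ cluster v) → Adj G u v
    adjacent empty = decidable-stable (adj? G u v) λ ¬uv → meet ¬uv (<-cmp (rank u) (rank v))
      where
      u≢v : u ≢ v
      u≢v refl = empty (suc u , x∈p∩q⁺ (∈cluster⁺ (inj₁ refl) , ∈cluster⁺ (inj₁ refl)))

      meet : ¬ Adj G u v → ¬ Tri (rank u < rank v) (rank u ≡ rank v) (rank v < rank u)
      meet ¬uv (tri≈ _ eq _)  = u≢v (injective u∈ v∈ eq)
      meet ¬uv (tri> _ _ v<u) = later⇒meet (((u∈ , v∈) , u≢v , ¬uv) , v<u) empty
      meet ¬uv (tri< u<v _ _) = later⇒meet′ (((v∈ , u∈) , u≢v ∘ sym , ¬uv ∘ symm G) , u<v) empty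

  isDisjointnessGraph : IsDisjointnessGraph G
  isDisjointnessGraph = suc k , ∣ V ∣ , T , T-isTree , F , record
    { bijection = mk↔ₛ′ (λ v → index V v , ∈⊤) (λ (j , _) → element V j)
                    (λ (j , j∈) → vertex-≡ (index-element V j)) (element-index V)
    ; adj⇔      = λ u v → subst₂ (λ a b → Adj G (proj₁ u) (proj₁ v) ⇔ Empty (cluster a ∩ cluster b))
                    (sym (cong proj₁ (element-index V u))) (sym (cong proj₁ (element-index V v)))
                    (adj⇔disjoint (proj₂ u) (proj₂ v))
    }
    where
    F : Fin ∣ V ∣ → Subtree T
    F j = clusterSubtree (proj₁ (element V j))

    vertex-≡ : ∀ {m} {p : Subset m} {i j} {i∈ : i ∈ p} {j∈ : j ∈ p} → i ≡ j → (i , i∈) ≡ (j , j∈)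
    vertex-≡ {i∈ = i∈} {j∈} refl = cong (_ ,_) ([]=-irrelevant i∈ j∈)

theorem6 : ∀ {k} (G : Graph k) →
    (∀ {n m} (T : Graph n) → IsTree T →
    (F : Fin m → Subtree T) → G ≅ disjointnessGraph F →
    ∃₂ λ (c p : ℕ) → IsC G c × IsP G p × c ≤ p × p ≤ 2)
    × (IsDisjointnessGraph G ⇔ IsChordal (complement G))
theorem6 G =
  (λ T isTree F iso → parameters G (Pullback.pull-partition iso (Family.partition isTree F))) ,
  mk⇔ (λ (_ , _ , _ , isTree , F , iso) → Family.chordal isTree F iso)
      (Representation.isDisjointnessGraph G)
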